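{- Let $O$ be a total order of cardinality $\aleph$ (finite or infinite), and let $\alpha(\aleph)$ be the least ordinal of cardinality $\aleph$. Then $O$ has a strict binary questionable representation of length at most $\alpha(\aleph)+1$; more precisely, there is an order embedding of $O$ into $\mathrm{Next}(1,\alpha(\aleph)+1,(O^{0,1})_{\alpha(\aleph)+1})$ in which any two distinct images have a question.
   Context: Orders are partial orders (strict relation $<$); for elements $x,y$ we write $x\sim y$ when $x\neq y$ and neither $x<y$ nor $y<x$. $O^{0,1}$ denotes the two-element total order $0<1$. For an ordinal $j$, a sequence of orders $\mathcal O_j=(O_k)_{k<j}$ is indexed by the ordinals $k<j$; $(O')_j$ denotes the constant sequence with all items equal to $O'$. For an ordinal $\ell\le j$, a word of length $\ell$ over $\mathcal O_j$ is a sequence $X=(x_k)_{k<\ell}$ with $x_k\in\mathrm{Dom}(O_k)$. For two words $X,Y$, if there is a least ordinal $k<\min(\mathrm{len}X,\mathrm{len}Y)$ with $x_k\ne y_k$, then $(k,x_k,y_k)$ is the question of $X,Y$; otherwise $X,Y$ have no question. For ordinals $i<j$, $\mathrm{Next}(i,j,\mathcal O_j)$ is the partial order whose domain is the set of all words over $\mathcal O_j$ of length $\ell$ with $i\le\ell<j$, where $X<Y$ iff $X,Y$ have a question $(k,x_k,y_k)$ with $x_k<y_k$ in $O_k$; words with no question, or whose question has $x_k\sim y_k$ in $O_k$, are incomparable. A questionable representation of an order $O$ is an injective map $f$ from $\mathrm{Dom}(O)$ into $\mathrm{Dom}(\mathrm{Next}(i,j,\mathcal O_j))$ (for some $i<j$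 and $\mathcal O_j$) such that for all $x,y$: $f(x)<f(y)$ iff $x<y$ (so incomparability is also preserved). Its length is $j$, its width is the supremum of the cardinalities of the $\mathrm{Dom}(O_k)$, $k<j$. It is strict if any two distinct images have a question, total if every $O_k$ is a total order, and binary if it is total of width 2. -}

module Defs where

open import Level using (Level; _⊔_; Lift; lift; 0ℓ) renaming (suc to lsuc)
open import Data.Bool.Properties using () renaming (<-strictPartialOrder to Bool-strictPartialOrder)
open import Data.Empty using (⊥)
open import Data.Fin using (Fin)
open import Data.Product using (Σ-syntax; ∃-syntax; _×_; _,_; proj₁; proj₂)
open import Function.Bundles using (Bijection; Injection; _⇔_)
open import Induction.WellFounded using (WellFounded; Acc; acc)
open import Relation.Binary.Bundles using (Setoid; StrictPartialOrder)
open import Relation.Binary.Construct.Add.Supremum.Strict as Supremum using ([_]; [_]<⊤⁺)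
open import Relation.Binary.Core using (Rel)
open import Relation.Binary.Definitions using (Trichotomous; tri<; tri≈; tri>)
open import Relation.Binary.Morphism.Structures using (IsOrderMonomorphism)
open import Relation.Binary.PropositionalEquality using (_≡_; refl; sym; trans; subst; setoid)
open import Relation.Binary.Structures using (IsStrictTotalOrder)
open import Relation.Nullary using (¬_)
open import Relation.Nullary.Construct.Add.Supremum using (_⁺; [_]; ⊤⁺)

private
  variable
    a b o c ℓ₁ ℓ₂ : Level

-- An ordinal is represented by a well-ordered type; the ordinals k < α
-- are the elements of its carrier.

record Ordinal a : Set (lsuc a) where
  infix 4 _<_
  field
    Carrier            : Set a
    _<_                : Rel Carrier a
    isStrictTotalOrder : IsStrictTotalOrder _≡_ _<_
    wellFounded        : WellFounded _<_

  open IsStrictTotalOrder isStrictTotalOrder public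
    using (compare; irrefl) renaming (trans to <-trans)

-- α ≤ₒ β: α is isomorphic to an initial segment of β.

infix 4 _≤ₒ_ _<ₒ_

record _≤ₒ_ (α : Ordinal a) (β : Ordinal b) : Set (a ⊔ b) where
  private
    module α = Ordinal α
    module β = Ordinal β
  field
    embed   : α.Carrier → β.Carrier
    mono    : ∀ {x y} → x α.< y → embed x β.< embed y
    initial : ∀ {x y} → y β.< embed x → ∃[ z ] embed z ≡ y

open _≤ₒ_ public using (embed)

-- For ℓ an element of β, regarded as the ordinal {k ∣ k < ℓ}: α ≤ ℓ and α = ℓ.

AtMost : (α : Ordinal a) (β : Ordinal b) → Ordinal.Carrier β → Set (a ⊔ b)
AtMost α β ℓ = Σ[ e ∈ α ≤ₒ β ] (∀ x → Ordinal._<_ β (embed e x) ℓ)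

Is : (α : Ordinal a) (β : Ordinal b) → Ordinal.Carrier β → Set (a ⊔ b)
Is α β ℓ = Σ[ e ∈ α ≤ₒ β ] (∀ y → Ordinal._<_ β y ℓ ⇔ (∃[ x ] embed e x ≡ y))

_<ₒ_ : Ordinal a → Ordinal b → Set (a ⊔ b)
α <ₒ β = ∃[ ℓ ] Is α β ℓ

zeroₒ : Ordinal a
zeroₒ {a} = record
  { Carrier            = Lift a ⊥
  ; _<_                = λ _ _ → Lift a ⊥
  ; isStrictTotalOrder = record
    { isStrictPartialOrder = record
      { isEquivalence = Setoid.isEquivalence (setoid _)
      ; irrefl        = λ { {lift ()} }
      ; trans         = λ { {lift ()} }
      ; <-resp-≈      = (λ { {lift ()} }) , (λ { {lift ()} })
      }
    ; compare = λ { (lift ()) }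
    }
  ; wellFounded = λ { (lift ()) }
  }

sucₒ : Ordinal a → Ordinal a
sucₒ α = record
  { Carrier            = α.Carrier ⁺
  ; _<_                = _<⁺_
  ; isStrictTotalOrder = Supremum.<⁺-isStrictTotalOrder-≡ α._<_ α.isStrictTotalOrder
  ; wellFounded        = wf
  }
  where
  module α = Ordinal α
  open Supremum α._<_ using (_<⁺_)

  wf-[] : ∀ {x} → Acc α._<_ x → Acc _<⁺_ [ x ]
  wf-[] (acc rs) = acc λ { [ y<x ] → wf-[] (rs y<x) }

  wf : WellFounded _<⁺_
  wf [ x ] = wf-[] (α.wellFounded x)
  wf ⊤⁺    = acc λ { [ k ]<⊤⁺ → wf-[] (α.wellFounded k) }

oneₒ : Ordinal a
oneₒ = sucₒ zeroₒ

HasCardinalityOf : Ordinal a → Setoid c ℓ₁ → Set (a ⊔ c ⊔ ℓ₁)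
HasCardinalityOf α S = Bijection (setoid (Ordinal.Carrier α)) S

record IsLeastOrdinalOfCardinalityOf (α : Ordinal a) (S : Setoid c ℓ₁) : Set (lsuc a ⊔ c ⊔ ℓ₁) where
  field
    bijection : HasCardinalityOf α S
    least     : (β : Ordinal a) → HasCardinalityOf β S → α ≤ₒ β

Order : ∀ o → Set (lsuc o)
Order o = StrictPartialOrder o o o

O⁰¹ : Order 0ℓ
O⁰¹ = Bool-strictPartialOrder

OrderSequence : Ordinal a → ∀ o → Set (a ⊔ lsuc o)
OrderSequence j o = Ordinal.Carrier j → Order o

constant : (j : Ordinal a) → Order o → OrderSequence j o
constant _ O′ _ = O′

module _ (j : Ordinal a) (𝒪 : OrderSequence j o) where

  private
    module j = Ordinal j
    module 𝒪 k = StrictPartialOrder (𝒪 k)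

  -- Words of length < j. The argument k < length is irrelevant because _<_ is
  -- not required to be proposition-valued.

  record Word : Set (a ⊔ o) where
    field
      length : j.Carrier
      at     : ∀ k → .(k j.< length) → 𝒪.Carrier k

  open Word

  record _≈ʷ_ (X Y : Word) : Set (a ⊔ o) where
    field
      length-≡ : length X ≡ length Y
      at-≈     : ∀ k .(k<X : k j.< length X) .(k<Y : k j.< length Y) → 𝒪._≈_ k (at X k k<X) (at Y k k<Y)

  record Question (X Y : Word) : Set (a ⊔ o) where
    field
      position : j.Carrier
      <-left   : position j.< length X
      <-right  : position j.< length Y
      differ   : ¬ 𝒪._≈_ position (at X position <-left) (at Y position <-right)
      agree    : ∀ {m} (m<k : m j.< position) → 𝒪._≈_ m (at X m (j.<-trans m<k <-left)) (at Y m (j.<-trans m<k <-right))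

    left right : 𝒪.Carrier position
    left  = at X position <-left
    right = at Y position <-right

  _<ʷ_ : Rel Word (a ⊔ o)
  X <ʷ Y = Σ[ q ∈ Question X Y ] (let open Question q in 𝒪._<_ position left right)

  private
    open module E {X Y} (e : X ≈ʷ Y) = _≈ʷ_ e
    open module Q {X Y} (q : Question X Y) = Question q

  ≈ʷ-sym : ∀ {X Y} → X ≈ʷ Y → Y ≈ʷ X
  ≈ʷ-sym e .length-≡ = sym (length-≡ e)
  ≈ʷ-sym e .at-≈ k p q = 𝒪.Eq.sym k (at-≈ e k q p)

  ≈ʷ-trans : ∀ {X Y Z} → X ≈ʷ Y → Y ≈ʷ Z → X ≈ʷ Z
  ≈ʷ-trans e f .length-≡ = trans (length-≡ e) (length-≡ f)
  ≈ʷ-trans e f .at-≈ k p q = 𝒪.Eq.trans k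
    (at-≈ e k p (subst (k j.<_) (length-≡ e) p))
    (at-≈ f k (subst (k j.<_) (length-≡ e) p) q)

  <ʷ-irrefl : ∀ {X Y} → X ≈ʷ Y → ¬ (X <ʷ Y)
  <ʷ-irrefl e (q , _) = differ q (at-≈ e (position q) (<-left q) (<-right q))

  mk< : ∀ {X Y} k (k<X : k j.< length X) (k<Y : k j.< length Y) →
        𝒪._<_ k (at X k k<X) (at Y k k<Y) →
        (∀ {m} (m<k : m j.< k) → 𝒪._≈_ m (at X m (j.<-trans m<k k<X)) (at Y m (j.<-trans m<k k<Y))) →
        X <ʷ Y
  mk< k k<X k<Y x<y agr = record
    { position = k ; <-left = k<X ; <-right = k<Y
    ; differ = λ x≈y → 𝒪.irrefl k x≈y x<y ; agree = agr } , x<y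

  <ʷ-trans : ∀ {X Y Z} → X <ʷ Y → Y <ʷ Z → X <ʷ Z
  <ʷ-trans (p , x<y) (q , y<z) with j.compare (position p) (position q)
  ... | tri< k<l _ _ = mk< (position p) (<-left p) (j.<-trans k<l (<-right q))
    (𝒪.<-respʳ-≈ _ (agree q k<l) x<y)
    (λ m<k → 𝒪.Eq.trans _ (agree p m<k) (agree q (j.<-trans m<k k<l)))
  ... | tri≈ _ refl _ = mk< (position p) (<-left p) (<-right q)
    (𝒪.trans _ x<y y<z)
    (λ m<k → 𝒪.Eq.trans _ (agree p m<k) (agree q m<k))
  ... | tri> _ _ l<k = mk< (position q) (j.<-trans l<k (<-left p)) (<-right q)
    (𝒪.<-respˡ-≈ _ (𝒪.Eq.sym _ (agree p l<k)) y<z)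
    (λ m<l → 𝒪.Eq.trans _ (agree p (j.<-trans m<l l<k)) (agree q m<l))

  <ʷ-respʳ : ∀ {X Y Z} → Y ≈ʷ Z → X <ʷ Y → X <ʷ Z
  <ʷ-respʳ e (q , x<y) = mk< (position q) (<-left q) k<Z
    (𝒪.<-respʳ-≈ _ (at-≈ e _ (<-right q) k<Z) x<y)
    (λ m<k → 𝒪.Eq.trans _ (agree q m<k) (at-≈ e _ (j.<-trans m<k (<-right q)) (j.<-trans m<k k<Z)))
    where k<Z = subst (position q j.<_) (length-≡ e) (<-right q)

  <ʷ-respˡ : ∀ {X Y Z} → Y ≈ʷ Z → Y <ʷ X → Z <ʷ X
  <ʷ-respˡ e (q , y<x) = mk< (position q) k<Z (<-right q)
    (𝒪.<-respˡ-≈ _ (at-≈ e _ (<-left q) k<Z) y<x)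
    (λ m<k → 𝒪.Eq.trans _ (at-≈ (≈ʷ-sym e) _ (j.<-trans m<k k<Z) (j.<-trans m<k (<-left q))) (agree q m<k))
    where k<Z = subst (position q j.<_) (length-≡ e) (<-left q)

-- Defined for all i and j; when i < j fails there are no words of length ℓ with
-- i ≤ ℓ < j, and the order is empty.

Next : (i j : Ordinal a) → OrderSequence j o → Order (a ⊔ o)
Next i j 𝒪 = record
  { Carrier = Σ[ X ∈ Word j 𝒪 ] AtMost i j (Word.length X)
  ; _≈_     = λ X Y → _≈ʷ_ j 𝒪 (proj₁ X) (proj₁ Y)
  ; _<_     = λ X Y → _<ʷ_ j 𝒪 (proj₁ X) (proj₁ Y)
  ; isStrictPartialOrder = record
    { isEquivalence = record
      { refl  = record { length-≡ = refl ; at-≈ = λ k _ _ → StrictPartialOrder.Eq.refl (𝒪 k) }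
      ; sym   = ≈ʷ-sym j 𝒪
      ; trans = ≈ʷ-trans j 𝒪
      }
    ; irrefl   = <ʷ-irrefl j 𝒪
    ; trans    = <ʷ-trans j 𝒪
    ; <-resp-≈ = <ʷ-respʳ j 𝒪 , <ʷ-respˡ j 𝒪
    }
  }

record Embedding (O : StrictPartialOrder c ℓ₁ ℓ₂) (P : Order o) : Set (c ⊔ ℓ₁ ⊔ ℓ₂ ⊔ o) where
  private
    module O = StrictPartialOrder O
    module P = StrictPartialOrder P
  field
    map                 : O.Carrier → P.Carrier
    isOrderMonomorphism : IsOrderMonomorphism O._≈_ P._≈_ O._<_ P._<_ map

DistinctImagesHaveQuestion : {O : StrictPartialOrder c ℓ₁ ℓ₂} (i j : Ordinal a) (𝒪 : OrderSequence j o) →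
                             Embedding O (Next i j 𝒪) → Set (c ⊔ a ⊔ o)
DistinctImagesHaveQuestion i j 𝒪 f =
  ∀ x y → ¬ (map x ≈ map y) → Question j 𝒪 (proj₁ (map x)) (proj₁ (map y))
  where
  open Embedding f
  open StrictPartialOrder (Next i j 𝒪) using (_≈_)

-- W is a least upper bound, among cardinalities, of the family S.

IsSupremumOfCardinalities : {K : Set a} (W : Setoid c ℓ₁) (S : K → Setoid o o) → Set (lsuc (a ⊔ o) ⊔ c ⊔ ℓ₁)
IsSupremumOfCardinalities {a = a} {o = o} W S =
  (∀ k → Injection (S k) W) ×
  ((V : Setoid (a ⊔ o) (a ⊔ o)) → (∀ k → Injection (S k) V) → Injection W V)

record QuestionableRepresentation (O : StrictPartialOrder c ℓ₁ ℓ₂) a o : Set (c ⊔ ℓ₁ ⊔ ℓ₂ ⊔ lsuc (a ⊔ o)) where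
  field
    i j       : Ordinal a
    i<j       : i <ₒ j
    𝒪         : OrderSequence j o
    embedding : Embedding O (Next i j 𝒪)

  len : Ordinal a
  len = j

  HasWidth : ∀ {w e} → Setoid w e → Set (lsuc (a ⊔ o) ⊔ w ⊔ e)
  HasWidth W = IsSupremumOfCardinalities W (λ k → StrictPartialOrder.Eq.setoid (𝒪 k))

  IsStrict : Set (c ⊔ a ⊔ o)
  IsStrict = DistinctImagesHaveQuestion i j 𝒪 embedding

  IsTotal : Set (a ⊔ o)
  IsTotal = ∀ k → let open StrictPartialOrder (𝒪 k) in Trichotomous _≈_ _<_

  IsBinary : Set (lsuc (a ⊔ o))
  IsBinary = IsTotal × HasWidth (setoid (Fin 2))

{-# OPTIONS --safe #-}

-- Enumerate O as (b k), k < α, and send x to the word of length α whose k-th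
-- letter tells whether b k < x. If x < y, then the letters of x are pointwise
-- at most those of y, and they differ at the k with b k = x; the least such
-- difference is a question, which decides the pair in favour of y.

module Submission where

open import Defs
open import Level using (Level; 0ℓ; Lift; lift)
open import Axiom.ExcludedMiddle using (ExcludedMiddle)
open import Data.Bool.Base using (Bool; false; f<t) renaming (_<_ to _<ᵇ_)
open import Data.Bool.Properties using () renaming (<-cmp to Bool-<-cmp)
open import Data.Fin.Properties using (2↔Bool)
open import Data.Product using (Σ-syntax; ∃-syntax; _×_; _,_; proj₁; proj₂)
open import Data.Unit.Base using (⊤)
open import Function.Base using (id; _∘_)
open import Function.Bundles using (Bijection; mk⇔)
open import Function.Construct.Composition using (injection)
open import Function.Construct.Symmetry using (↔-sym)
open import Function.Properties.Inverse using (Inverse⇒Injection)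
open import Induction.WellFounded using (Acc; acc)
open import Relation.Binary.Bundles using (StrictPartialOrder; StrictTotalOrder)
open import Relation.Binary.Construct.Add.Supremum.Strict using ([_]; [_]<⊤⁺)
open import Relation.Binary.Definitions using (tri<; tri≈; tri>)
open import Relation.Binary.PropositionalEquality using (_≡_; refl)
open import Relation.Nullary using (¬_; yes; no; does; contradiction)
open import Relation.Nullary.Construct.Add.Supremum using (_⁺; [_]; ⊤⁺)

module _ {a} (em : ExcludedMiddle a) (α : Ordinal a) where

  open Ordinal α

  -- Descent along the well-founded order: excluded middle decides whether a smaller witness exists,
  -- and the descent stops when none does.
  leastWitness : (P : Carrier → Set a) → ∃[ k ] P k → ∃[ k ] P k × (∀ {m} → m < k → ¬ P m)
  leastWitness P (k , Pk) = go (wellFounded k) Pk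
    where
    go : ∀ {k} → Acc _<_ k → P k → ∃[ l ] P l × (∀ {m} → m < l → ¬ P m)
    go {k} (acc rs) Pk with em {∃[ m ] m < k × P m}
    ... | yes (m , m<k , Pm) = go (rs m<k) Pm
    ... | no ∄m              = k , Pk , λ m<k Pm → ∄m (_ , m<k , Pm)

  leastElement : Carrier → ∃[ l ] (∀ {m} → ¬ m < l)
  leastElement k with leastWitness (λ _ → Lift a ⊤) (k , _)
  ... | l , _ , least = l , λ m<l → least m<l _

module _ {a} (α : Ordinal a) where

  ≤ₒ-refl : α ≤ₒ α
  ≤ₒ-refl = record { embed = id ; mono = id ; initial = λ _ → _ , refl }

  zeroₒ≤ₒ : zeroₒ {a} ≤ₒ α
  zeroₒ≤ₒ = record
    { embed   = λ { (lift ()) }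
    ; mono    = λ { {lift ()} }
    ; initial = λ { {lift ()} }
    }

  -- The position that represents 0 is the least element, which exists as soon as there is any
  -- element.
  zeroₒ<ₒ : ExcludedMiddle a → Ordinal.Carrier α → zeroₒ {a} <ₒ α
  zeroₒ<ₒ em k with leastElement em α k
  ... | l , least = l , zeroₒ≤ₒ , λ y → mk⇔ (λ y<l → contradiction y<l least) (λ { (lift () , _) })

  -- Words of length `⊤⁺` have length `α`, and `α` is at least 1 once it has an element: the point
  -- of `oneₒ` goes to the least one, so its image is an initial segment.
  oneₒ-atMost-⊤⁺ : ExcludedMiddle a → Ordinal.Carrier α → AtMost (oneₒ {a}) (sucₒ α) ⊤⁺
  oneₒ-atMost-⊤⁺ em k with leastElement em α k
  ... | l , least = record
    { embed   = λ _ → [ l ]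
    ; mono    = λ { [ lift () ] ; [ lift () ]<⊤⁺ }
    ; initial = λ { [ y<l ] → contradiction y<l least }
    } , λ _ → [ l ]<⊤⁺

question-sym : ∀ {a o} (j : Ordinal a) (𝒪 : OrderSequence j o) {X Y : Word j 𝒪} →
               Question j 𝒪 X Y → Question j 𝒪 Y X
question-sym j 𝒪 q = record
  { position = position
  ; <-left   = <-right
  ; <-right  = <-left
  ; differ   = differ ∘ Eq.sym (𝒪 position)
  ; agree    = λ {m} m<k → Eq.sym (𝒪 m) (agree m<k)
  }
  where
  open Question q
  open StrictPartialOrder using (module Eq)

module CutEmbedding {ℓ} (em : ExcludedMiddle ℓ) (O : StrictTotalOrder ℓ ℓ ℓ) (α : Ordinal ℓ)
                    (enum : HasCardinalityOf α (StrictTotalOrder.Eq.setoid O)) where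

  private
    module O = StrictTotalOrder O
    module α = Ordinal α
    b = Bijection.to enum

    index : O.Carrier → α.Carrier
    index x = proj₁ (Bijection.surjective enum x)

    b-index : ∀ x → b (index x) O.≈ x
    b-index x = proj₂ (Bijection.surjective enum x) refl

    j = sucₒ α
    𝟚 = constant j O⁰¹

  -- Only the letters at positions [ k ] matter, since the words have length ⊤⁺.
  letter : O.Carrier → α.Carrier ⁺ → Bool
  letter x [ k ] = does (b k O.<? x)
  letter x ⊤⁺    = false

  word : O.Carrier → Word j 𝟚
  word x = record { length = ⊤⁺ ; at = λ k _ → letter x k }

  -- Reduces equality of letters to an equivalence, which `word-cong` gets from congruence and
  -- `word-mono` from minimality.
  letter-≡ : ∀ {x y} k → (b k O.< x → b k O.< y) → (b k O.< y → b k O.< x) →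
             letter x [ k ] ≡ letter y [ k ]
  letter-≡ {x} {y} k to from with b k O.<? x | b k O.<? y
  ... | yes _  | yes _  = refl
  ... | yes <x | no ≮y  = contradiction (to <x) ≮y
  ... | no ≮x  | yes <y = contradiction (from <y) ≮x
  ... | no _   | no _   = refl

  word-cong : ∀ {x y} → x O.≈ y → _≈ʷ_ j 𝟚 (word x) (word y)
  word-cong x≈y = record { length-≡ = refl ; at-≈ = λ k _ _ → eq k }
    where
    eq : ∀ k → letter _ k ≡ letter _ k
    eq [ k ] = letter-≡ k (O.<-respʳ-≈ x≈y) (O.<-respʳ-≈ (O.Eq.sym x≈y))
    eq ⊤⁺    = refl

  word-mono : ∀ {x y} → x O.< y → _<ʷ_ j 𝟚 (word x) (word y)
  word-mono {x} {y} x<y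
    -- By totality these `k` are those with `x ≤ b k < y`, exactly the positions where the letters
    -- differ; `index x` is one of them.
    with leastWitness em α (λ k → ¬ (b k O.< x) × b k O.< y)
           (index x , O.irrefl (b-index x) , O.<-respˡ-≈ (O.Eq.sym (b-index x)) x<y)
  ... | k , (k≮x , k<y) , least = mk< j 𝟚 [ k ] [ k ]<⊤⁺ [ k ]<⊤⁺ x₀<y₁ (λ { [ m<k ] → agree m<k })
    where
    x₀<y₁ : letter x [ k ] <ᵇ letter y [ k ]
    x₀<y₁ with b k O.<? x | b k O.<? y
    ... | yes k<x | _      = contradiction k<x k≮x
    ... | no _    | no k≮y = contradiction k<y k≮y
    ... | no _    | yes _  = f<t

    agree : ∀ {m} → m α.< k → letter x [ m ] ≡ letter y [ m ]
    -- One implication is transitivity; for the other, an `m` with `b m < y` but not `b m < x` would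
    -- be a witness smaller than `k`.
    agree {m} m<k = letter-≡ m (λ m<x → O.trans m<x x<y) from
      where
      from : b m O.< y → b m O.< x
      from m<y with b m O.<? x
      ... | yes m<x = m<x
      ... | no m≮x  = contradiction (m≮x , m<y) (least m<k)

  word-injective : ∀ {x y} → _≈ʷ_ j 𝟚 (word x) (word y) → x O.≈ y
  word-injective {x} {y} e with O.compare x y
  ... | tri< x<y _ _ = contradiction (word-mono x<y) (<ʷ-irrefl j 𝟚 e)
  ... | tri≈ _ x≈y _ = x≈y
  ... | tri> _ _ y<x = contradiction (word-mono y<x) (<ʷ-irrefl j 𝟚 (≈ʷ-sym j 𝟚 e))

  -- Totality of `O` makes preservation enough: in either other case the word of `x` would lie below
  -- itself.
  word-cancel : ∀ {x y} → _<ʷ_ j 𝟚 (word x) (word y) → x O.< y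
  word-cancel {x} {y} X<Y with O.compare x y
  ... | tri< x<y _ _ = x<y
  ... | tri≈ _ x≈y _ = contradiction X<Y (<ʷ-irrefl j 𝟚 (word-cong x≈y))
  ... | tri> _ _ y<x = contradiction (<ʷ-trans j 𝟚 X<Y (word-mono y<x))
                                     (<ʷ-irrefl j 𝟚 (word-cong O.Eq.refl))

  word-question : ∀ x y → ¬ (_≈ʷ_ j 𝟚 (word x) (word y)) → Question j 𝟚 (word x) (word y)
  word-question x y X≉Y with O.compare x y
  ... | tri< x<y _ _ = proj₁ (word-mono x<y)
  ... | tri≈ _ x≈y _ = contradiction (word-cong x≈y) X≉Y
  ... | tri> _ _ y<x = question-sym j 𝟚 (proj₁ (word-mono y<x))

  -- The bound `i` is kept general to serve both 0 and 1. It is asked for only in the presence of an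
  -- element of `O`, so that an empty `O` is covered.
  embedding : (i : Ordinal ℓ) → (O.Carrier → AtMost i j ⊤⁺) → Embedding O.strictPartialOrder (Next i j 𝟚)
  embedding i i≤ = record
    { map = λ x → word x , i≤ x
    ; isOrderMonomorphism = record
      { isOrderHomomorphism = record { cong = word-cong ; mono = word-mono }
      ; injective = word-injective
      ; cancel    = word-cancel
      }
    }

  -- Words of length ≥ 0 rather than ≥ 1: for empty O, α + 1 = 1 and oneₒ <ₒ j fails.
  representation : QuestionableRepresentation O.strictPartialOrder ℓ 0ℓ
  representation = record
    { i         = zeroₒ
    ; j         = j
    ; i<j       = zeroₒ<ₒ j em ⊤⁺
    ; 𝒪         = 𝟚
    ; embedding = embedding zeroₒ λ _ → zeroₒ≤ₒ j , λ { (lift ()) }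
    }

  representation-isBinary : QuestionableRepresentation.IsBinary representation
  representation-isBinary =
    (λ _ → Bool-<-cmp) ,
    (λ _ → Inverse⇒Injection (↔-sym 2↔Bool)) ,
    -- The position `⊤⁺` exists even when `α` is empty, so every upper bound receives a copy of
    -- `Bool`.
    (λ V inj → injection (Inverse⇒Injection 2↔Bool) (inj ⊤⁺))

  -- Each element of `O` has an index, which shows that `α` is nonempty.
  oneₒ-embedding : Embedding O.strictPartialOrder (Next oneₒ j 𝟚)
  oneₒ-embedding = embedding oneₒ (oneₒ-atMost-⊤⁺ α em ∘ index)

mainTheorem1 : ∀ {ℓ : Level} → ExcludedMiddle ℓ →
    (O : StrictTotalOrder ℓ ℓ ℓ) (α : Ordinal ℓ) →
    IsLeastOrdinalOfCardinalityOf α (StrictTotalOrder.Eq.setoid O) →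
    (Σ[ R ∈ QuestionableRepresentation (StrictTotalOrder.strictPartialOrder O) ℓ 0ℓ ]
    (let open QuestionableRepresentation R in IsStrict × IsBinary × len ≤ₒ sucₒ α))
    ×
    (Σ[ f ∈ Embedding (StrictTotalOrder.strictPartialOrder O) (Next oneₒ (sucₒ α) (constant (sucₒ α) O⁰¹)) ]
    DistinctImagesHaveQuestion oneₒ (sucₒ α) (constant (sucₒ α) O⁰¹) f)
mainTheorem1 em O α isLeast =
  (representation , word-question , representation-isBinary , ≤ₒ-refl (sucₒ α)) ,
  (oneₒ-embedding , word-question)
  where open CutEmbedding em O α (IsLeastOrdinalOfCardinalityOf.bijection isLeast)
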